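{- Every amoeba is balanceable.
   Context: Graphs are finite and simple; $n(G)=|V(G)|$, $e(G)=|E(G)|$. Amoebas. Isolated vertices play no role here, so copies of $G$ in $K_n$ are regarded as determined by their edge sets. For a graph $G$ embedded in $K_n$, $n\ge n(G)$, a graph $H$ embedded in $K_n$ is obtained from $G$ by an edge-replacement if for some $e_1\in E(G)$ and $e_2\in E(K_n)\setminus E(G)$ we have $E(H)=(E(G)\setminus\{e_1\})\cup\{e_2\}$. A graph $G$ is an amoeba if there is an integer $n_0=n_0(G)>n(G)$ such that for all $n\ge n_0$ and any two copies $F$ and $H$ of $G$ in $K_n$ there is a chain $F=G_0,G_1,\dots,G_t=H$ such that, for every $i\in\{1,\dots,t\}$, $G_i\cong G$ and $G_i$ is obtained from $G_{i-1}$ by an edge-replacement. Balanceable graphs. A $2$-coloring $E(K_n)=E(R)\cup E(B)$ is a partition of the edges of $K_n$ into red edges (forming $R$) and blue edges (forming $B$). An $(r,b)$-colored copy of $G$ (with $r+b=e(G)$) is a (not necessarily induced) subgraph of $K_n$ isomorphic to $G$ with exactly $r$ red and $b$ blue edges. A balanced copy of $G$ is an $(e(G)/2,e(G)/2)$-colored copy if $e(G)$ is even, and a copy that is either $(\lceil e(G)/2\rceil,\lfloor e(G)/2\rfloor)$-colored or $(\lfloor e(G)/2\rfloor,\lceil e(G)/2\rceil)$-colored if $e(G)$ is odd. ${\rm bal}(n,G)$ is the minimum non-negative integer $s$ such that every $2$-coloring $E(K_n)=E(R)\cup E(B)$ with $\min\{e(R),e(B)\}>s$ contains a balanced copy of $G$.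 The graph $G$ is balanceable if for every sufficiently large $n$ such an integer exists non-vacuously, that is, ${\rm bal}(n,G)<\lfloor\frac12\binom n2\rfloor$ (so that there are colorings with $\min\{e(R),e(B)\}>{\rm bal}(n,G)$). -}

module Defs where

open import Data.Bool using (Bool; _∧_; T; T?)
open import Data.Bool.Properties using (T-∧)
open import Data.Fin using (Fin; zero; suc; fromℕ; inject₁; _<?_)
open import Data.List using (List; length; filter; allFin; cartesianProduct)
open import Data.Nat using (ℕ; suc; _<_; _≤_; _⊓_; ⌊_/2⌋; ⌈_/2⌉)
open import Data.Nat.Combinatorics using (_C_)
open import Data.Product using (Σ; _×_; _,_; ∃; ∃-syntax; Σ-syntax)
open import Data.Sum using (_⊎_)
open import Function.Bundles using (_⇔_; Equivalence)
open import Function.Definitions using (Injective)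
open import Relation.Binary.Definitions using (Symmetric; Irreflexive)
open import Relation.Binary.PropositionalEquality using (_≡_; _≢_)
open import Relation.Nullary using (¬_)
open import Relation.Nullary.Decidable using (_×-dec_)

-- Adjacency is Boolean so that edge sets are decidable and edges can be counted.
record Graph (n : ℕ) : Set where
  field
    adj : Fin n → Fin n → Bool

  Adj : Fin n → Fin n → Set
  Adj u v = T (adj u v)

  field
    symmetric   : Symmetric Adj
    irreflexive : Irreflexive _≡_ Adj

open Graph public using (Adj)

-- Each edge {u , v} is listed once, as the pair with u < v.
edges : ∀ {n} → Graph n → List (Fin n × Fin n)
edges {n} G =
  filter (λ (u , v) → (u <? v) ×-dec T? (Graph.adj G u v))
         (cartesianProduct (allFin n) (allFin n))

e : ∀ {n} → Graph n → ℕ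
e G = length (edges G)

infix 4 _≈_

-- Equality of edge sets; propositional equality of the records would be finer,
-- since functions are not extensional here.
_≈_ : ∀ {n} → Graph n → Graph n → Set
F ≈ H = ∀ u v → Adj F u v ⇔ Adj H u v

infixl 7 _∩_

_∩_ : ∀ {n} → Graph n → Graph n → Graph n
F ∩ H = record
  { adj         = λ u v → Graph.adj F u v ∧ Graph.adj H u v
  ; symmetric   = λ p → let (a , b) = Equivalence.to T-∧ p in
                    Equivalence.from T-∧ (Graph.symmetric F a , Graph.symmetric H b)
  ; irreflexive = λ u≡v p → let (a , _) = Equivalence.to T-∧ p in
                    Graph.irreflexive F u≡v a
  }

-- A graph on Fin n doubles as a subgraph of K_n given by its edge set: F is a
-- copy of G when E(F) is the image of E(G) under an injection of the vertices.
-- Vertices of Fin n not met by F are not part of the copy.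
IsCopy : ∀ {m n} → Graph m → Graph n → Set
IsCopy {m} {n} G F =
  Σ[ f ∈ (Fin m → Fin n) ]
    Injective _≡_ _≡_ f ×
    (∀ u v → Adj F u v ⇔ (∃[ a ] ∃[ b ] f a ≡ u × f b ≡ v × Adj G a b))

SameEdge : ∀ {n} → Fin n → Fin n → Fin n → Fin n → Set
SameEdge u v a b = (u ≡ a × v ≡ b) ⊎ (u ≡ b × v ≡ a)

-- e₁ = {a , b} is an edge of G, e₂ = {c , d} is an edge of K_n outside G, and
-- E(H) = (E(G) ∖ {e₁}) ∪ {e₂}.
EdgeReplacement : ∀ {n} → Graph n → Graph n → Set
EdgeReplacement G H =
  ∃[ a ] ∃[ b ] ∃[ c ] ∃[ d ]
    Adj G a b × (c ≢ d × ¬ Adj G c d) ×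
    (∀ u v → Adj H u v ⇔ ((Adj G u v × ¬ SameEdge u v a b) ⊎ SameEdge u v c d))

Chain : ∀ {m n} → Graph m → Graph n → Graph n → Set
Chain {n = n} G F H =
  ∃[ t ] Σ[ S ∈ (Fin (suc t) → Graph n) ]
    S zero ≈ F × S (fromℕ t) ≈ H ×
    (∀ (i : Fin t) → IsCopy G (S (suc i)) × EdgeReplacement (S (inject₁ i)) (S (suc i)))

Amoeba : ∀ {m} → Graph m → Set
Amoeba {m} G =
  ∃[ n₀ ] m < n₀ ×
    (∀ n → n₀ ≤ n → (F H : Graph n) → IsCopy G F → IsCopy G H → Chain G F H)

record Coloring (n : ℕ) : Set where
  field
    R B      : Graph n
    covers   : ∀ u v → u ≢ v → Adj R u v ⊎ Adj B u v
    disjoint : ∀ u v → ¬ (Adj R u v × Adj B u v)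

ColoredCopy : ∀ {m n} → Graph m → Coloring n → ℕ → ℕ → Set
ColoredCopy {n = n} G χ r b =
  Σ[ H ∈ Graph n ] IsCopy G H × e (H ∩ R) ≡ r × e (H ∩ B) ≡ b
  where open Coloring χ

-- When e G is even, the two alternatives coincide.
BalancedCopy : ∀ {m n} → Graph m → Coloring n → Set
BalancedCopy G χ =
  ColoredCopy G χ ⌈ e G /2⌉ ⌊ e G /2⌋ ⊎ ColoredCopy G χ ⌊ e G /2⌋ ⌈ e G /2⌉

ForcesBalanced : ∀ {m} → ℕ → Graph m → ℕ → Set
ForcesBalanced n G s =
  (χ : Coloring n) → s < e (Coloring.R χ) ⊓ e (Coloring.B χ) → BalancedCopy G χ

-- bal(n,G) = s, as a relation.
IsBal : ∀ {m} → ℕ → Graph m → ℕ → Set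
IsBal n G s = ForcesBalanced n G s × (∀ s′ → ForcesBalanced n G s′ → s ≤ s′)

Balanceable : ∀ {m} → Graph m → Set
Balanceable G =
  ∃[ N ] (∀ n → N ≤ n → ∃[ s ] IsBal n G s × s < ⌊ n C 2 /2⌋)

{-# OPTIONS --safe #-}
module Submission where

-- Only colorings with min(e(R), e(B)) = ⌊C(n,2)/2⌋ matter for Balanceable. In such
-- a coloring a random copy of G has, up to an error smaller than 1, as many red as
-- blue edges on average, so some copy F has e(F ∩ R) ≤ e(F ∩ B) and some copy H has
-- e(H ∩ B) ≤ e(H ∩ R). Along a chain of edge-replacements from F to H the number of
-- red edges grows by at most one per step, hence takes the value ⌊e(G)/2⌋.
-- The least s exists constructively because ForcesBalanced is decidable.

open import Defs
open import Data.Bool using (Bool; true; false; if_then_else_; _∧_; T; T?)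
open import Data.Bool.Properties using (T-∧)
open import Data.Fin using (Fin; zero; suc; fromℕ; inject₁; punchIn)
import Data.Fin as Fin
import Data.Fin.Properties as Finₚ
open import Data.Fin.Subset using (Subset)
open import Data.Fin.Subset.Properties using (anySubset?)
open import Data.List using (List; []; _∷_; _++_; length; filter; map; tabulate; allFin; cartesianProduct)
open import Data.List.Properties using (map-++; map-∘)
open import Data.Nat
open import Data.Nat.Combinatorics using (_C_; nCk+nC[k+1]≡[n+1]C[k+1]; nC1≡n)
open import Data.Nat.ListAction using () renaming (sum to sumᴸ)
open import Data.Nat.ListAction.Properties using (sum-++)
open import Data.Nat.Properties
open import Data.Nat.Tactic.RingSolver using (solve-∀)
open import Data.Product using (_×_; _,_; ∃; ∃-syntax; proj₁; proj₂; uncurry)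
open import Data.Sum using (_⊎_; inj₁; inj₂; [_,_]; swap)
import Data.Sum as Sum
open import Data.Unit using (tt)
open import Data.Vec using (Vec; []; _∷_)
import Data.Vec as Vec
open import Data.Vec.Properties using (lookup∘tabulate)
open import Function using (_∘_; flip; id)
open import Function.Bundles using (_⇔_; Equivalence; mk⇔)
open import Function.Definitions using (Injective)
import Function.Properties.Equivalence as ⇔
open import Relation.Binary.Definitions using (Symmetric; Irreflexive; tri<; tri≈; tri>)
import Relation.Binary.Definitions as Binary
open import Relation.Binary.PropositionalEquality
  using (_≡_; _≢_; refl; sym; trans; cong; cong₂; subst)
open import Relation.Nullary using (¬_; Dec; yes; no; contradiction; does)
open import Relation.Nullary.Decidable
  using (⌊_⌋; ¬?; _×-dec_; _⊎-dec_; _→-dec_; map′; toWitness; fromWitness; decidable-stable;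
         toSum; dec-true; dec-false)
open import Relation.Unary using (Decidable)
open import Algebra.Properties.Semiring.Sum +-*-semiring
  using (sum; sum-syntax; sum-cong-≗; sum-remove; sum-replicate-zero; ∑-distrib-+; ∑-comm; *-distribˡ-sum)

open ≤-Reasoning

-- The largest `s` that balanceability admits is one below half of C(n,2); if it forces a balanced
-- copy, the least forcing `s` is no larger. This is why only nearly equal colour classes have to be
-- treated.
--
-- Averages stay in ℕ as sums over all injections `f`, and edges are counted as ordered pairs, so
-- every count is doubled. The classes differ by at most one edge, that is, by 2 in ordered pairs.
-- Let d be the number of ordered adjacent pairs of G. The mean excess of one colour over the other
-- is at most 2d / (n (n - 1)), which is below 2 because n > n(G) gives d < n (n - 1). Doubled
-- counts are even, so an injection with excess below 2 has no excess.
--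
-- Functions are not extensional, so graphs are compared by `≈`, and exhaustive searches run over
-- vectors and are transported along `≈`.

-- Single and double sums over finite index sets

sum-mono-≤ : ∀ {n} {f g : Fin n → ℕ} → (∀ i → f i ≤ g i) → sum f ≤ sum g
sum-mono-≤ {zero}  f≤g = z≤n
sum-mono-≤ {suc n} f≤g = +-mono-≤ (f≤g zero) (sum-mono-≤ (f≤g ∘ suc))

sum-<⇒∃< : ∀ {n} (f g : Fin n → ℕ) → sum f < sum g → ∃[ i ] f i < g i
sum-<⇒∃< {suc n} f g Σf<Σg with f zero <? g zero
... | yes f₀<g₀ = zero , f₀<g₀
... | no  f₀≮g₀ =
  let i , fᵢ<gᵢ = sum-<⇒∃< (f ∘ suc) (g ∘ suc)
                    (≰⇒> λ Σg≤Σf → <⇒≱ Σf<Σg (+-mono-≤ (≮⇒≥ f₀≮g₀) Σg≤Σf))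
  in suc i , fᵢ<gᵢ

sum-const : ∀ n c → ∑[ i < n ] c ≡ n * c
sum-const zero    c = refl
sum-const (suc n) c = cong (c +_) (sum-const n c)

sum-zero : ∀ {n} {f : Fin n → ℕ} → (∀ i → f i ≡ 0) → sum f ≡ 0
sum-zero {n} f≗0 = trans (sum-cong-≗ f≗0) (sum-replicate-zero n)

sum-single : ∀ {n} {f : Fin n → ℕ} i → (∀ j → j ≢ i → f j ≡ 0) → sum f ≡ f i
sum-single {suc n} {f} i f≗0 = begin-equality
  sum f                        ≡⟨ sum-remove {i = i} f ⟩
  f i + sum (f ∘ punchIn i)    ≡⟨ cong (f i +_) (sum-zero (λ j → f≗0 _ (Finₚ.punchInᵢ≢i i j))) ⟩
  f i + 0                      ≡⟨ +-identityʳ _ ⟩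
  f i                          ∎

∑∑ : ∀ {n} → (Fin n → Fin n → ℕ) → ℕ
∑∑ w = sum λ u → sum (w u)

∑∑-cong : ∀ {n} {w w′ : Fin n → Fin n → ℕ} → (∀ u v → w u v ≡ w′ u v) → ∑∑ w ≡ ∑∑ w′
∑∑-cong eq = sum-cong-≗ λ u → sum-cong-≗ (eq u)

∑∑-mono-≤ : ∀ {n} {w w′ : Fin n → Fin n → ℕ} → (∀ u v → w u v ≤ w′ u v) → ∑∑ w ≤ ∑∑ w′
∑∑-mono-≤ le = sum-mono-≤ λ u → sum-mono-≤ (le u)

∑∑-distrib-+ : ∀ {n} (w w′ : Fin n → Fin n → ℕ) → ∑∑ (λ u v → w u v + w′ u v) ≡ ∑∑ w + ∑∑ w′
∑∑-distrib-+ w w′ = trans (sum-cong-≗ λ u → ∑-distrib-+ (w u) (w′ u)) (∑-distrib-+ (sum ∘ w) (sum ∘ w′))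

*-distribˡ-∑∑ : ∀ {n} c (w : Fin n → Fin n → ℕ) → c * ∑∑ w ≡ ∑∑ λ u v → c * w u v
*-distribˡ-∑∑ c w = trans (*-distribˡ-sum c (sum ∘ w)) (sum-cong-≗ λ u → *-distribˡ-sum c (w u))

∑∑-const : ∀ n c → ∑∑ {n} (λ _ _ → c) ≡ n * (n * c)
∑∑-const n c = trans (sum-cong-≗ {n} λ _ → sum-const n c) (sum-const n (n * c))

∑∑-single : ∀ {n} {w : Fin n → Fin n → ℕ} a b → (∀ u v → ¬ (u ≡ a × v ≡ b) → w u v ≡ 0) → ∑∑ w ≡ w a b
∑∑-single a b w≗0 = trans
  (sum-single a (λ u u≢a → sum-zero λ v → w≗0 u v (u≢a ∘ proj₁)))
  (sum-single b (λ v v≢b → w≗0 a v (v≢b ∘ proj₂)))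

-- Row `x` and column `x` share only the entry `w x x`; as it is zero, both may be summed in full.
∑∑-remove : ∀ {n} (w : Fin (suc n) → Fin (suc n) → ℕ) → (∀ u → w u u ≡ 0) → ∀ x →
            ∑∑ w ≡ sum (w x) + sum (flip w x) + ∑∑ (λ u v → w (punchIn x u) (punchIn x v))
∑∑-remove w w₀ x = begin-equality
  ∑∑ w
    ≡⟨ sum-remove {i = x} (sum ∘ w) ⟩
  sum (w x) + sum (λ u → sum (w (punchIn x u)))
    ≡⟨ cong (sum (w x) +_) (sum-cong-≗ λ u → sum-remove {i = x} (w (punchIn x u))) ⟩
  sum (w x) + sum (λ u → w (punchIn x u) x + sum (w (punchIn x u) ∘ punchIn x))
    ≡⟨ cong (sum (w x) +_) (∑-distrib-+ (λ u → w (punchIn x u) x) _) ⟩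
  sum (w x) + (sum (λ u → w (punchIn x u) x) + inner)
    ≡⟨ +-assoc (sum (w x)) _ _ ⟨
  sum (w x) + sum (λ u → w (punchIn x u) x) + inner
    ≡⟨ cong (λ s → sum (w x) + s + inner) (trans (sum-remove {i = x} (flip w x)) (cong (_+ sum (λ u → w (punchIn x u) x)) (w₀ x))) ⟨
  sum (w x) + sum (flip w x) + inner ∎
  where inner = ∑∑ (λ u v → w (punchIn x u) (punchIn x v))

-- Each index is missing for exactly one of the `suc n` choices of `x`. Adding `sum h` to both sides
-- puts the missing terms back and avoids subtraction.
∑-removeAt : ∀ {n} (h : Fin (suc n) → ℕ) → sum (λ x → sum (h ∘ punchIn x)) ≡ n * sum h
∑-removeAt {n} h = +-cancelˡ-≡ (sum h) _ _ (begin-equality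
  sum h + sum (λ x → sum (h ∘ punchIn x))   ≡⟨ ∑-distrib-+ h (λ x → sum (h ∘ punchIn x)) ⟨
  sum (λ x → h x + sum (h ∘ punchIn x))     ≡⟨ sum-cong-≗ (λ x → sum-remove {i = x} h) ⟨
  sum {suc n} (λ x → sum h)                 ≡⟨ sum-const (suc n) (sum h) ⟩
  suc n * sum h                             ∎)

-- An off-diagonal pair survives the removal of `x` for all but two of the `2 + n` choices. The lost
-- pairs are those in row or column `x`, which over all `x` add up to `∑∑ w + ∑∑ w`.
∑-∑∑-removeAt : ∀ {n} (w : Fin (2 + n) → Fin (2 + n) → ℕ) → (∀ u → w u u ≡ 0) →
                sum (λ x → ∑∑ (λ u v → w (punchIn x u) (punchIn x v))) ≡ n * ∑∑ w
∑-∑∑-removeAt {n} w w₀ = +-cancelˡ-≡ (∑∑ w + ∑∑ w) _ _ (begin-equality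
  ∑∑ w + ∑∑ w + sum inner
    ≡⟨ cong (λ s → ∑∑ w + s + sum inner) (∑-comm w) ⟩
  ∑∑ w + ∑∑ (flip w) + sum inner
    ≡⟨ cong (_+ sum inner) (∑-distrib-+ (sum ∘ w) (sum ∘ flip w)) ⟨
  sum (λ x → sum (w x) + sum (flip w x)) + sum inner
    ≡⟨ ∑-distrib-+ (λ x → sum (w x) + sum (flip w x)) inner ⟨
  sum (λ x → sum (w x) + sum (flip w x) + inner x)
    ≡⟨ sum-cong-≗ (∑∑-remove w w₀) ⟨
  sum {2 + n} (λ x → ∑∑ w)
    ≡⟨ sum-const (2 + n) (∑∑ w) ⟩
  (2 + n) * ∑∑ w
    ≡⟨ +-assoc (∑∑ w) (∑∑ w) (n * ∑∑ w) ⟨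
  ∑∑ w + ∑∑ w + n * ∑∑ w ∎)
  where
  inner : Fin (2 + n) → ℕ
  inner x = ∑∑ (λ u v → w (punchIn x u) (punchIn x v))

-- Averaging over injections

-- Sums over the injections Fin m → Fin n: the value x at zero is free, and the
-- remaining values form an injection into the complement of x.

infixr 5 _◂_

_◂_ : ∀ {m n} → Fin (suc n) → (Fin m → Fin n) → Fin (suc m) → Fin (suc n)
(x ◂ g) zero    = x
(x ◂ g) (suc a) = punchIn x (g a)

◂-injective : ∀ {m n} x {g : Fin m → Fin n} → Injective _≡_ _≡_ g → Injective _≡_ _≡_ (x ◂ g)
◂-injective x g-inj {zero}  {zero}  eq = refl
◂-injective x g-inj {zero}  {suc b} eq = contradiction (sym eq) (Finₚ.punchInᵢ≢i x _)
◂-injective x g-inj {suc a} {zero}  eq = contradiction eq (Finₚ.punchInᵢ≢i x _)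
◂-injective x g-inj {suc a} {suc b} eq = cong suc (g-inj (Finₚ.punchIn-injective x _ _ eq))

∑-inj : ∀ m n → ((Fin m → Fin n) → ℕ) → ℕ
∑-inj zero    n       F = F λ ()
∑-inj (suc m) zero    F = 0
∑-inj (suc m) (suc n) F = sum λ x → ∑-inj m n λ g → F (x ◂ g)

-- The falling factorial n (n - 1) ... (n - m + 1), which is 0 for m > n.
#inj : ℕ → ℕ → ℕ
#inj zero    n       = 1
#inj (suc m) zero    = 0
#inj (suc m) (suc n) = suc n * #inj m n

#inj>0 : ∀ {m n} → m ≤ n → 0 < #inj m n
#inj>0 z≤n       = s≤s z≤n
#inj>0 {suc m} {suc n} (s≤s m≤n) = *-mono-≤ {1} {suc n} (s≤s z≤n) (#inj>0 m≤n)

∑-inj-<⇒∃< : ∀ m n {F F′ : (Fin m → Fin n) → ℕ} → ∑-inj m n F < ∑-inj m n F′ →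
             ∃[ f ] Injective _≡_ _≡_ f × F f < F′ f
∑-inj-<⇒∃< zero    n       lt = (λ ()) , (λ { {()} }) , lt
∑-inj-<⇒∃< (suc m) (suc n) {F} {F′} lt =
  let x , lt′         = sum-<⇒∃< (λ x → ∑-inj m n (F ∘ (x ◂_))) (λ x → ∑-inj m n (F′ ∘ (x ◂_))) lt
      g , g-inj , lt″ = ∑-inj-<⇒∃< m n {F ∘ (x ◂_)} {F′ ∘ (x ◂_)} lt′
  in x ◂ g , ◂-injective x g-inj , lt″

∑-inj-cong : ∀ m n {F F′ : (Fin m → Fin n) → ℕ} → (∀ f → F f ≡ F′ f) → ∑-inj m n F ≡ ∑-inj m n F′
∑-inj-cong zero    n       eq = eq _
∑-inj-cong (suc m) zero    eq = refl
∑-inj-cong (suc m) (suc n) eq = sum-cong-≗ λ x → ∑-inj-cong m n λ g → eq (x ◂ g)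

∑-inj-distrib-+ : ∀ m n (F F′ : (Fin m → Fin n) → ℕ) →
                  ∑-inj m n (λ f → F f + F′ f) ≡ ∑-inj m n F + ∑-inj m n F′
∑-inj-distrib-+ zero    n       F F′ = refl
∑-inj-distrib-+ (suc m) zero    F F′ = refl
∑-inj-distrib-+ (suc m) (suc n) F F′ =
  trans (sum-cong-≗ λ x → ∑-inj-distrib-+ m n (F ∘ (x ◂_)) (F′ ∘ (x ◂_)))
        (∑-distrib-+ (λ x → ∑-inj m n (F ∘ (x ◂_))) (λ x → ∑-inj m n (F′ ∘ (x ◂_))))

∑-inj-const : ∀ m n c → ∑-inj m n (λ _ → c) ≡ #inj m n * c
∑-inj-const zero    n       c = sym (+-identityʳ c)
∑-inj-const (suc m) zero    c = refl
∑-inj-const (suc m) (suc n) c = begin-equality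
  sum {suc n} (λ _ → ∑-inj m n λ _ → c)   ≡⟨ sum-const (suc n) _ ⟩
  suc n * ∑-inj m n (λ _ → c)             ≡⟨ cong (suc n *_) (∑-inj-const m n c) ⟩
  suc n * (#inj m n * c)                  ≡⟨ *-assoc (suc n) (#inj m n) c ⟨
  suc n * #inj m n * c                    ∎

*-distribˡ-∑-inj : ∀ m n c (F : (Fin m → Fin n) → ℕ) → c * ∑-inj m n F ≡ ∑-inj m n λ f → c * F f
*-distribˡ-∑-inj zero    n       c F = refl
*-distribˡ-∑-inj (suc m) zero    c F = *-zeroʳ c
*-distribˡ-∑-inj (suc m) (suc n) c F =
  trans (*-distribˡ-sum c (λ x → ∑-inj m n (F ∘ (x ◂_)))) (sum-cong-≗ λ x → *-distribˡ-∑-inj m n c (F ∘ (x ◂_)))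

∑-inj-∑ : ∀ m n {k} (F : Fin k → (Fin m → Fin n) → ℕ) →
          ∑-inj m n (λ f → sum λ i → F i f) ≡ sum λ i → ∑-inj m n (F i)
∑-inj-∑ m n {zero}  F = trans (∑-inj-const m n 0) (*-zeroʳ (#inj m n))
∑-inj-∑ m n {suc k} F =
  trans (∑-inj-distrib-+ m n (F zero) _) (cong (∑-inj m n (F zero) +_) (∑-inj-∑ m n (F ∘ suc)))

*-swap : ∀ a b c → a * (b * c) ≡ b * a * c
*-swap = solve-∀

-- By symmetry each vertex is the image of `a` under equally many injections: once `f a` is fixed,
-- the rest is an injection into one vertex fewer. For `suc a` the value at zero is removed first,
-- and `∑-removeAt` supplies the factor that completes the falling factorial.
∑-inj-point : ∀ m n (h : Fin (suc n) → ℕ) a →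
              ∑-inj (suc m) (suc n) (λ f → h (f a)) ≡ #inj m n * sum h
∑-inj-point m n h zero = begin-equality
  sum (λ x → ∑-inj m n λ _ → h x)   ≡⟨ sum-cong-≗ (λ x → ∑-inj-const m n (h x)) ⟩
  sum (λ x → #inj m n * h x)        ≡⟨ *-distribˡ-sum (#inj m n) h ⟨
  #inj m n * sum h                  ∎
∑-inj-point (suc m) zero    h (suc a) = refl
∑-inj-point (suc m) (suc n) h (suc a) = begin-equality
  sum (λ x → ∑-inj (suc m) (suc n) λ g → h (punchIn x (g a)))
    ≡⟨ sum-cong-≗ (λ x → ∑-inj-point m n (h ∘ punchIn x) a) ⟩
  sum (λ x → #inj m n * sum (h ∘ punchIn x))
    ≡⟨ *-distribˡ-sum (#inj m n) (λ x → sum (h ∘ punchIn x)) ⟨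
  #inj m n * sum (λ x → sum (h ∘ punchIn x))
    ≡⟨ cong (#inj m n *_) (∑-removeAt h) ⟩
  #inj m n * (suc n * sum h)
    ≡⟨ *-swap (#inj m n) (suc n) (sum h) ⟩
  suc n * #inj m n * sum h ∎

-- The pair `(f a , f b)` is uniformly distributed over ordered pairs of distinct vertices, and the
-- zero diagonal lets `∑∑ w` stand for the sum over those. Symmetry of `w` reduces the case in which
-- `b` is zero to the one in which `a` is.
∑-inj-pair : ∀ m n (w : Fin (2 + n) → Fin (2 + n) → ℕ) →
             (∀ u → w u u ≡ 0) → (∀ u v → w u v ≡ w v u) → ∀ {a b} → a ≢ b →
             ∑-inj (2 + m) (2 + n) (λ f → w (f a) (f b)) ≡ #inj m n * ∑∑ w
∑-inj-pair m n w w₀ w-sym {zero}  {zero}  a≢b = contradiction refl a≢b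
∑-inj-pair m n w w₀ w-sym {zero}  {suc b} a≢b = begin-equality
  sum (λ x → ∑-inj (suc m) (suc n) λ g → w x (punchIn x (g b)))
    ≡⟨ sum-cong-≗ (λ x → ∑-inj-point m n (w x ∘ punchIn x) b) ⟩
  sum (λ x → #inj m n * sum (w x ∘ punchIn x))
    ≡⟨ *-distribˡ-sum (#inj m n) (λ x → sum (w x ∘ punchIn x)) ⟨
  #inj m n * sum (λ x → sum (w x ∘ punchIn x))
    ≡⟨ cong (#inj m n *_) (sum-cong-≗ λ x → trans (sum-remove {i = x} (w x)) (cong (_+ sum (w x ∘ punchIn x)) (w₀ x))) ⟨
  #inj m n * ∑∑ w ∎
∑-inj-pair m n w w₀ w-sym {suc a} {zero}  a≢b = trans
  (∑-inj-cong (2 + m) (2 + n) (λ f → w-sym (f (suc a)) (f zero)))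
  (∑-inj-pair m n w w₀ w-sym {zero} {suc a} λ ())
∑-inj-pair zero    n       w w₀ w-sym {suc zero} {suc zero} a≢b = contradiction refl a≢b
∑-inj-pair (suc m) zero    w w₀ w-sym {suc a} {suc b} a≢b = refl
∑-inj-pair (suc m) (suc n) w w₀ w-sym {suc a} {suc b} a≢b = begin-equality
  sum (λ x → ∑-inj (2 + m) (2 + n) λ g → w (punchIn x (g a)) (punchIn x (g b)))
    ≡⟨ sum-cong-≗ (λ x → ∑-inj-pair m n (λ u v → w (punchIn x u) (punchIn x v))
                           (λ _ → w₀ _) (λ _ _ → w-sym _ _) (a≢b ∘ cong suc)) ⟩
  sum (λ x → #inj m n * ∑∑ (λ u v → w (punchIn x u) (punchIn x v)))
    ≡⟨ *-distribˡ-sum (#inj m n) (λ x → ∑∑ (λ u v → w (punchIn x u) (punchIn x v))) ⟨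
  #inj m n * sum (λ x → ∑∑ (λ u v → w (punchIn x u) (punchIn x v)))
    ≡⟨ cong (#inj m n *_) (∑-∑∑-removeAt w w₀) ⟩
  #inj m n * (suc n * ∑∑ w)
    ≡⟨ *-swap (#inj m n) (suc n) (∑∑ w) ⟩
  suc n * #inj m n * ∑∑ w ∎

-- Edge counts as sums over ordered pairs

open Equivalence using (to; from)
open Coloring using (R; B; covers; disjoint)

ι : Bool → ℕ
ι b = if b then 1 else 0

ι-true : ∀ {b} → T b → ι b ≡ 1
ι-true {true} _ = refl

ι-false : ∀ {b} → ¬ T b → ι b ≡ 0
ι-false {false} _  = refl
ι-false {true}  ¬t = contradiction tt ¬t

ι-cong : ∀ {b c} → T b ⇔ T c → ι b ≡ ι c
ι-cong {true}  eq = sym (ι-true (to eq tt))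
ι-cong {false} eq = sym (ι-false (from eq))

ι-≤ : ∀ {b k} → (T b → 1 ≤ k) → ι b ≤ k
ι-≤ {true}  h = h tt
ι-≤ {false} h = z≤n

ι-∧ : ∀ b c → ι (b ∧ c) ≡ ι b * ι c
ι-∧ true  c = sym (+-identityʳ (ι c))
ι-∧ false c = refl

module _ {A : Set} where

  length-filter : ∀ {P : A → Set} (P? : Decidable P) xs →
                  length (filter P? xs) ≡ sumᴸ (map (ι ∘ does ∘ P?) xs)
  length-filter P? []       = refl
  length-filter P? (x ∷ xs) with does (P? x)
  ... | true  = cong suc (length-filter P? xs)
  ... | false = length-filter P? xs

  sum-map-tabulate : ∀ {n} (f : A → ℕ) (g : Fin n → A) → sumᴸ (map f (tabulate g)) ≡ sum (f ∘ g)
  sum-map-tabulate {zero}  f g = refl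
  sum-map-tabulate {suc n} f g = cong (f (g zero) +_) (sum-map-tabulate f (g ∘ suc))

  sum-map-cartesianProduct : ∀ (f : A × A → ℕ) xs ys →
    sumᴸ (map f (cartesianProduct xs ys)) ≡ sumᴸ (map (λ x → sumᴸ (map (λ y → f (x , y)) ys)) xs)
  sum-map-cartesianProduct f []       ys = refl
  sum-map-cartesianProduct f (x ∷ xs) ys = begin-equality
    sumᴸ (map f (map (x ,_) ys ++ cartesianProduct xs ys))
      ≡⟨ cong sumᴸ (map-++ f (map (x ,_) ys) _) ⟩
    sumᴸ (map f (map (x ,_) ys) ++ map f (cartesianProduct xs ys))
      ≡⟨ sum-++ (map f (map (x ,_) ys)) _ ⟩
    sumᴸ (map f (map (x ,_) ys)) + sumᴸ (map f (cartesianProduct xs ys))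
      ≡⟨ cong₂ _+_ (cong sumᴸ (sym (map-∘ ys))) (sum-map-cartesianProduct f xs ys) ⟩
    sumᴸ (map (λ y → f (x , y)) ys) + sumᴸ (map (λ x → sumᴸ (map (λ y → f (x , y)) ys)) xs) ∎

adjℕ : ∀ {n} → Graph n → Fin n → Fin n → ℕ
adjℕ F u v = ι (Graph.adj F u v)

adjℕ-diag : ∀ {n} (F : Graph n) u → adjℕ F u u ≡ 0
adjℕ-diag F u = ι-false (Graph.irreflexive F refl)

adjℕ-sym : ∀ {n} (F : Graph n) u v → adjℕ F u v ≡ adjℕ F v u
adjℕ-sym F u v = ι-cong (mk⇔ (Graph.symmetric F) (Graph.symmetric F))

-- Injections need not preserve the order of vertices, so a listing by `u < v` does not transport
-- along them, while a sum over ordered pairs does. Edge counts are therefore compared doubled and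
-- halved at the end.
handshake : ∀ {n} (F : Graph n) → ∑∑ (adjℕ F) ≡ e F + e F
handshake {n} F = begin-equality
  ∑∑ (adjℕ F)                           ≡⟨ ∑∑-cong split ⟩
  ∑∑ (λ u v → up u v + up v u)          ≡⟨ ∑∑-distrib-+ up (flip up) ⟩
  ∑∑ up + ∑∑ (flip up)                  ≡⟨ cong (∑∑ up +_) (∑-comm (flip up)) ⟩
  ∑∑ up + ∑∑ up                         ≡⟨ cong₂ _+_ (sym e≡) (sym e≡) ⟩
  e F + e F                             ∎
  where
  up : Fin n → Fin n → ℕ
  up u v = ι (does (u Fin.<? v) ∧ Graph.adj F u v)

  e≡ : e F ≡ ∑∑ up
  e≡ = begin-equality
    e F
      ≡⟨ length-filter _ (cartesianProduct (allFin n) (allFin n)) ⟩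
    sumᴸ (map (uncurry up) (cartesianProduct (allFin n) (allFin n)))
      ≡⟨ sum-map-cartesianProduct (uncurry up) (allFin n) (allFin n) ⟩
    sumᴸ (map (λ u → sumᴸ (map (up u) (allFin n))) (allFin n))
      ≡⟨ sum-map-tabulate (λ u → sumᴸ (map (up u) (allFin n))) id ⟩
    sum (λ u → sumᴸ (map (up u) (allFin n)))
      ≡⟨ sum-cong-≗ (λ u → sum-map-tabulate (up u) id) ⟩
    ∑∑ up ∎

  split : ∀ u v → adjℕ F u v ≡ up u v + up v u
  split u v with Finₚ.<-cmp u v
  ... | tri< u<v _ v≮u rewrite dec-true (u Fin.<? v) u<v | dec-false (v Fin.<? u) v≮u =
    sym (+-identityʳ _)
  ... | tri≈ _ refl _ rewrite ι-false {Graph.adj F u u} (Graph.irreflexive F refl) | dec-false (u Fin.<? u) (Finₚ.<-irrefl refl) = refl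
  ... | tri> u≮v _ v<u rewrite dec-false (u Fin.<? v) u≮v | dec-true (v Fin.<? u) v<u =
    adjℕ-sym F u v

double-suc : ∀ k → k + k + 2 ≡ suc k + suc k
double-suc = solve-∀

double-cancel-≤ : ∀ {a b} → a + a ≤ b + b → a ≤ b
double-cancel-≤ {a} {b} le = ≮⇒≥ λ b<a → <⇒≱ (+-mono-< b<a b<a) le

double-cancel-≡ : ∀ {a b} → a + a ≡ b + b → a ≡ b
double-cancel-≡ eq = ≤-antisym (double-cancel-≤ (≤-reflexive eq)) (double-cancel-≤ (≤-reflexive (sym eq)))

e-cong : ∀ {n} {F H : Graph n} → F ≈ H → e F ≡ e H
e-cong {F = F} {H} F≈H = double-cancel-≡
  (trans (sym (handshake F)) (trans (∑∑-cong λ u v → ι-cong (F≈H u v)) (handshake H)))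

∩-cong : ∀ {n} {F F′ H H′ : Graph n} → F ≈ F′ → H ≈ H′ → F ∩ H ≈ F′ ∩ H′
∩-cong F≈F′ H≈H′ u v = mk⇔
  (λ p → let a , b = to T-∧ p in from T-∧ (to (F≈F′ u v) a , to (H≈H′ u v) b))
  (λ p → let a , b = to T-∧ p in from T-∧ (from (F≈F′ u v) a , from (H≈H′ u v) b))

≈-sym : ∀ {n} {F H : Graph n} → F ≈ H → H ≈ F
≈-sym F≈H u v = ⇔.sym (F≈H u v)

≈-refl : ∀ {n} {F : Graph n} → F ≈ F
≈-refl u v = ⇔.refl

IsCopy-resp-≈ : ∀ {m n} {G : Graph m} {F H : Graph n} → F ≈ H → IsCopy G F → IsCopy G H
IsCopy-resp-≈ F≈H (f , f-inj , adj) = f , f-inj , λ u v → ⇔.trans (⇔.sym (F≈H u v)) (adj u v)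

-- Graphs from decidable relations, and images of a graph

module _ {n} {P : Fin n → Fin n → Set} (P? : Binary.Decidable P) (P-sym : Symmetric P) (P-irr : Irreflexive _≡_ P) where

  ofDec : Graph n
  ofDec = record
    { adj         = λ u v → ⌊ P? u v ⌋
    ; symmetric   = λ {u} {v} p → fromWitness {a? = P? v u} (P-sym (toWitness {a? = P? u v} p))
    ; irreflexive = λ {u} {v} u≡v p → P-irr u≡v (toWitness {a? = P? u v} p)
    }

  Adj-ofDec : ∀ u v → Adj ofDec u v ⇔ P u v
  Adj-ofDec u v = mk⇔ toWitness fromWitness

Image : ∀ {m n} → Graph m → (Fin m → Fin n) → Fin n → Fin n → Set
Image G f u v = ∃[ a ] ∃[ b ] f a ≡ u × f b ≡ v × Adj G a b

-- The condition u ≢ v is automatic when f is injective; it makes image G f a graph for every f.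
module _ {m n} (G : Graph m) (f : Fin m → Fin n) where

  ImageEdge : Fin n → Fin n → Set
  ImageEdge u v = u ≢ v × Image G f u v

  imageEdge? : Binary.Decidable ImageEdge
  imageEdge? u v = ¬? (u Finₚ.≟ v) ×-dec Finₚ.any? λ a → Finₚ.any? λ b →
    f a Finₚ.≟ u ×-dec f b Finₚ.≟ v ×-dec T? (Graph.adj G a b)

  imageEdge-sym : Symmetric ImageEdge
  imageEdge-sym (u≢v , a , b , p , q , ab) = u≢v ∘ sym , b , a , q , p , Graph.symmetric G ab

  imageEdge-irrefl : Irreflexive _≡_ ImageEdge
  imageEdge-irrefl u≡v (u≢v , _) = u≢v u≡v

  image : Graph n
  image = ofDec imageEdge? imageEdge-sym imageEdge-irrefl

  image-adj : Injective _≡_ _≡_ f → ∀ u v → Adj image u v ⇔ Image G f u v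
  image-adj f-inj u v = ⇔.trans (Adj-ofDec imageEdge? imageEdge-sym imageEdge-irrefl u v)
    (mk⇔ proj₂ λ { im@(a , b , refl , refl , ab) → (λ fa≡fb → Graph.irreflexive G (f-inj fa≡fb) ab) , im })

  image-copy : Injective _≡_ _≡_ f → IsCopy G image
  image-copy f-inj = f , f-inj , image-adj f-inj

-- Edges that a copy shares with another graph

∑∑-comm : ∀ {m n} (X : Fin m → Fin m → Fin n → Fin n → ℕ) →
          ∑∑ (λ u v → ∑∑ (X u v)) ≡ ∑∑ (λ a b → ∑∑ (λ u v → X u v a b))
∑∑-comm X = begin-equality
  sum (λ u → sum λ v → sum λ a → sum λ b → X u v a b)
    ≡⟨ sum-cong-≗ (λ u → ∑-comm λ v a → sum λ b → X u v a b) ⟩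
  sum (λ u → sum λ a → sum λ v → sum λ b → X u v a b)
    ≡⟨ ∑-comm (λ u a → sum λ v → sum λ b → X u v a b) ⟩
  sum (λ a → sum λ u → sum λ v → sum λ b → X u v a b)
    ≡⟨ sum-cong-≗ (λ a → sum-cong-≗ λ u → ∑-comm λ v b → X u v a b) ⟩
  sum (λ a → sum λ u → sum λ b → sum λ v → X u v a b)
    ≡⟨ sum-cong-≗ (λ a → ∑-comm λ u b → sum λ v → X u v a b) ⟩
  sum (λ a → sum λ b → sum λ u → sum λ v → X u v a b) ∎

-- With `w = adjℕ H` and `f` injective, this is twice the number of edges that the copy of `G` along
-- `f` shares with `H`. It depends on the map alone, so it can be summed over injections.
weight : ∀ {m n} → Graph m → (Fin n → Fin n → ℕ) → (Fin m → Fin n) → ℕ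
weight G w f = ∑∑ λ a b → adjℕ G a b * w (f a) (f b)

-- Double counting of the quadruples with `f a ≡ u` and `f b ≡ v`. For fixed `a`, `b` there is one
-- such `(u , v)`; an edge of `F` has one preimage pair by injectivity, and a non-edge of `F` is hit
-- by non-edges of `G` only.
weight-copy : ∀ {m n} {G : Graph m} {F : Graph n} ((f , _) : IsCopy G F) (w : Fin n → Fin n → ℕ) →
              ∑∑ (λ u v → adjℕ F u v * w u v) ≡ weight G w f
weight-copy {m} {n} {G} {F} (f , f-inj , adj) w = begin-equality
  ∑∑ (λ u v → adjℕ F u v * w u v)      ≡⟨ ∑∑-cong spread ⟩
  ∑∑ (λ u v → ∑∑ (X u v))              ≡⟨ ∑∑-comm X ⟩
  ∑∑ (λ a b → ∑∑ (λ u v → X u v a b))  ≡⟨ ∑∑-cong collect ⟩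
  weight G w f                         ∎
  where
  hit? : ∀ u v a b → Dec (f a ≡ u × f b ≡ v)
  hit? u v a b = f a Finₚ.≟ u ×-dec f b Finₚ.≟ v

  X : Fin n → Fin n → Fin m → Fin m → ℕ
  X u v a b = ι (does (hit? u v a b)) * (adjℕ G a b * w u v)

  X-hit : ∀ {u v a b} → f a ≡ u × f b ≡ v → X u v a b ≡ adjℕ G a b * w u v
  X-hit {u} {v} {a} {b} h = trans
    (cong (λ t → ι t * (adjℕ G a b * w u v)) (dec-true (hit? u v a b) h)) (+-identityʳ _)

  X-miss : ∀ {u v a b} → ¬ (f a ≡ u × f b ≡ v) → X u v a b ≡ 0
  X-miss {u} {v} {a} {b} ¬h =
    cong (λ t → ι t * (adjℕ G a b * w u v)) (dec-false (hit? u v a b) ¬h)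

  collect : ∀ a b → ∑∑ (λ u v → X u v a b) ≡ adjℕ G a b * w (f a) (f b)
  collect a b = trans
    (∑∑-single (f a) (f b) λ u v ¬h → X-miss λ (p , q) → ¬h (sym p , sym q))
    (X-hit (refl , refl))

  spread : ∀ u v → adjℕ F u v * w u v ≡ ∑∑ (X u v)
  spread u v with T? (Graph.adj F u v)
  ... | yes uv =
    let a , b , p , q , ab = to (adj u v) uv in begin-equality
    adjℕ F u v * w u v   ≡⟨ cong (_* w u v) (trans (ι-true uv) (sym (ι-true ab))) ⟩
    adjℕ G a b * w u v   ≡⟨ X-hit (p , q) ⟨
    X u v a b            ≡⟨ ∑∑-single a b (λ a′ b′ ¬h → X-miss λ (p′ , q′) →
                              ¬h (f-inj (trans p′ (sym p)) , f-inj (trans q′ (sym q)))) ⟨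
    ∑∑ (X u v)           ∎
  ... | no ¬uv = begin-equality
    adjℕ F u v * w u v   ≡⟨ cong (_* w u v) (ι-false ¬uv) ⟩
    0                    ≡⟨ sum-zero {f = λ a → sum (X u v a)} (λ a → sum-zero (zeroX a)) ⟨
    ∑∑ (X u v)           ∎
    where
    zeroX : ∀ a b → X u v a b ≡ 0
    zeroX a b with hit? u v a b
    ... | no  ¬h        = X-miss ¬h
    ... | yes h@(p , q) = trans (X-hit h)
      (cong (_* w u v) (ι-false λ ab → ¬uv (from (adj u v) (a , b , p , q , ab))))

e-∩-copy : ∀ {m n} {G : Graph m} {F : Graph n} (c : IsCopy G F) (H : Graph n) →
           e (F ∩ H) + e (F ∩ H) ≡ weight G (adjℕ H) (proj₁ c)
e-∩-copy {G = G} {F} c H = begin-equality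
  e (F ∩ H) + e (F ∩ H)                  ≡⟨ handshake (F ∩ H) ⟨
  ∑∑ (adjℕ (F ∩ H))                      ≡⟨ ∑∑-cong (λ u v → ι-∧ (Graph.adj F u v) (Graph.adj H u v)) ⟩
  ∑∑ (λ u v → adjℕ F u v * adjℕ H u v)   ≡⟨ weight-copy {G = G} {F} c (adjℕ H) ⟩
  weight G (adjℕ H) (proj₁ c)            ∎

e-copy : ∀ {m n} {G : Graph m} {F : Graph n} → IsCopy G F → e F ≡ e G
e-copy {G = G} {F} c = double-cancel-≡ (begin-equality
  e F + e F                       ≡⟨ handshake F ⟨
  ∑∑ (adjℕ F)                     ≡⟨ ∑∑-cong (λ u v → sym (*-identityʳ (adjℕ F u v))) ⟩
  ∑∑ (λ u v → adjℕ F u v * 1)     ≡⟨ weight-copy {G = G} {F} c (λ _ _ → 1) ⟩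
  ∑∑ (λ a b → adjℕ G a b * 1)     ≡⟨ ∑∑-cong (λ a b → *-identityʳ (adjℕ G a b)) ⟩
  ∑∑ (adjℕ G)                     ≡⟨ handshake G ⟩
  e G + e G                       ∎)

-- Edge counts in a coloring

adjℕ-R+B : ∀ {n} (χ : Coloring n) {u v} → u ≢ v → adjℕ (R χ) u v + adjℕ (B χ) u v ≡ 1
adjℕ-R+B χ {u} {v} u≢v with covers χ u v u≢v
... | inj₁ r = cong₂ _+_ (ι-true r) (ι-false λ b → disjoint χ u v (r , b))
... | inj₂ b = cong₂ _+_ (ι-false λ r → disjoint χ u v (r , b)) (ι-true b)

e-R+B : ∀ {n} (χ : Coloring n) (F : Graph n) → e (F ∩ R χ) + e (F ∩ B χ) ≡ e F
e-R+B χ F = double-cancel-≡ (begin-equality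
  e FR + e FB + (e FR + e FB)              ≡⟨ lemma (e FR) (e FB) ⟩
  e FR + e FR + (e FB + e FB)              ≡⟨ cong₂ _+_ (handshake FR) (handshake FB) ⟨
  ∑∑ (adjℕ FR) + ∑∑ (adjℕ FB)              ≡⟨ ∑∑-distrib-+ (adjℕ FR) (adjℕ FB) ⟨
  ∑∑ (λ u v → adjℕ FR u v + adjℕ FB u v)   ≡⟨ ∑∑-cong pointwise ⟩
  ∑∑ (adjℕ F)                              ≡⟨ handshake F ⟩
  e F + e F                                ∎)
  where
  FR = F ∩ R χ
  FB = F ∩ B χ
  lemma : ∀ a b → a + b + (a + b) ≡ a + a + (b + b)
  lemma = solve-∀
  pointwise : ∀ u v → adjℕ FR u v + adjℕ FB u v ≡ adjℕ F u v
  pointwise u v with Graph.adj F u v | Graph.irreflexive F {u} {v}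
  ... | true  | irr = adjℕ-R+B χ λ u≡v → irr u≡v tt
  ... | false | _   = refl

-- Stated without subtraction so that it matches the split of all n² ordered pairs into edges
-- counted twice and the diagonal.
nC2 : ∀ n → n C 2 + n C 2 + n ≡ n * n
nC2 zero    = refl
nC2 (suc n) rewrite sym (nCk+nC[k+1]≡[n+1]C[k+1] n 1) | nC1≡n n = begin-equality
  n + n C 2 + (n + n C 2) + suc n   ≡⟨ lemma n (n C 2) ⟩
  n C 2 + n C 2 + n + suc (n + n)   ≡⟨ cong (_+ suc (n + n)) (nC2 n) ⟩
  n * n + suc (n + n)               ≡⟨ lemma′ n ⟩
  suc n * suc n                     ∎
  where
  lemma : ∀ n c → n + c + (n + c) + suc n ≡ c + c + n + suc (n + n)
  lemma = solve-∀
  lemma′ : ∀ n → n * n + suc (n + n) ≡ suc n * suc n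
  lemma′ = solve-∀

-- Every ordered pair is red, blue or diagonal, exactly one of the three. The diagonal indicator
-- `eq` completes the two adjacency functions to the constant 1.
coloring-e : ∀ {n} (χ : Coloring n) → e (R χ) + e (B χ) ≡ n C 2
coloring-e {n} χ = double-cancel-≡ (+-cancelʳ-≡ n _ _ (begin-equality
  e (R χ) + e (B χ) + (e (R χ) + e (B χ)) + n
    ≡⟨ lemma (e (R χ)) (e (B χ)) n ⟩
  e (R χ) + e (R χ) + (e (B χ) + e (B χ)) + n
    ≡⟨ cong₂ (λ a b → a + b + n) (handshake (R χ)) (handshake (B χ)) ⟨
  ∑∑ (adjℕ (R χ)) + ∑∑ (adjℕ (B χ)) + n
    ≡⟨ cong (∑∑ (adjℕ (R χ)) + ∑∑ (adjℕ (B χ)) +_) diagonal ⟨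
  ∑∑ (adjℕ (R χ)) + ∑∑ (adjℕ (B χ)) + ∑∑ eq
    ≡⟨ cong (_+ ∑∑ eq) (∑∑-distrib-+ (adjℕ (R χ)) (adjℕ (B χ))) ⟨
  ∑∑ (λ u v → adjℕ (R χ) u v + adjℕ (B χ) u v) + ∑∑ eq
    ≡⟨ ∑∑-distrib-+ (λ u v → adjℕ (R χ) u v + adjℕ (B χ) u v) eq ⟨
  ∑∑ (λ u v → adjℕ (R χ) u v + adjℕ (B χ) u v + eq u v)
    ≡⟨ ∑∑-cong pointwise ⟩
  ∑∑ {n} (λ _ _ → 1)
    ≡⟨ ∑∑-const n 1 ⟩
  n * (n * 1)
    ≡⟨ cong (n *_) (*-identityʳ n) ⟩
  n * n
    ≡⟨ nC2 n ⟨
  n C 2 + n C 2 + n ∎))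
  where
  lemma : ∀ a b n → a + b + (a + b) + n ≡ a + a + (b + b) + n
  lemma = solve-∀
  eq : Fin n → Fin n → ℕ
  eq u v = ι (does (u Finₚ.≟ v))
  diagonal : ∑∑ eq ≡ n
  diagonal = trans (sum-cong-≗ row) (trans (sum-const n 1) (*-identityʳ n))
    where
    row : ∀ u → sum (eq u) ≡ 1
    row u = trans
      (sum-single u λ v v≢u → cong ι (dec-false (u Finₚ.≟ v) (v≢u ∘ sym)))
      (cong ι (dec-true (u Finₚ.≟ u) refl))
  pointwise : ∀ u v → adjℕ (R χ) u v + adjℕ (B χ) u v + eq u v ≡ 1
  pointwise u v with u Finₚ.≟ v
  ... | yes refl = cong (_+ 1) (cong₂ _+_ (adjℕ-diag (R χ) u) (adjℕ-diag (B χ) u))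
  ... | no  u≢v  = trans (+-identityʳ _) (adjℕ-R+B χ u≢v)

-- Copies in which a given color is not in excess

-- Linearity of expectation: each ordered edge of `G` lands on a uniformly distributed pair and
-- contributes the same amount. Both sizes have the form `2 + _` because an edge needs two vertices.
∑-inj-weight : ∀ m n (G : Graph (2 + m)) (H : Graph (2 + n)) →
               ∑-inj (2 + m) (2 + n) (weight G (adjℕ H)) ≡ ∑∑ (adjℕ G) * (#inj m n * ∑∑ (adjℕ H))
∑-inj-weight m n G H = begin-equality
  ∑-inj (2 + m) (2 + n) (weight G (adjℕ H))
    ≡⟨ ∑-inj-∑ (2 + m) (2 + n) (λ a f → sum λ b → term a b f) ⟩
  sum (λ a → ∑-inj (2 + m) (2 + n) λ f → sum λ b → term a b f)
    ≡⟨ sum-cong-≗ (λ a → ∑-inj-∑ (2 + m) (2 + n) (term a)) ⟩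
  ∑∑ (λ a b → ∑-inj (2 + m) (2 + n) (term a b))
    ≡⟨ ∑∑-cong edge ⟩
  ∑∑ (λ a b → K * adjℕ G a b)
    ≡⟨ *-distribˡ-∑∑ K (adjℕ G) ⟨
  K * ∑∑ (adjℕ G)
    ≡⟨ *-comm K (∑∑ (adjℕ G)) ⟩
  ∑∑ (adjℕ G) * K ∎
  where
  K = #inj m n * ∑∑ (adjℕ H)

  term : Fin (2 + m) → Fin (2 + m) → (Fin (2 + m) → Fin (2 + n)) → ℕ
  term a b f = adjℕ G a b * adjℕ H (f a) (f b)

  edge : ∀ a b → ∑-inj (2 + m) (2 + n) (term a b) ≡ K * adjℕ G a b
  edge a b = trans (sym (*-distribˡ-∑-inj (2 + m) (2 + n) (adjℕ G a b) (λ f → adjℕ H (f a) (f b)))) (scaled (T? (Graph.adj G a b)))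
    where
    S = ∑-inj (2 + m) (2 + n) (λ f → adjℕ H (f a) (f b))
    -- `∑-inj-pair` needs `a ≢ b`, which adjacency supplies; for a non-edge both sides vanish.
    scaled : Dec (Adj G a b) → adjℕ G a b * S ≡ K * adjℕ G a b
    scaled (yes ab) = trans
      (cong (adjℕ G a b *_) (∑-inj-pair m n (adjℕ H) (adjℕ-diag H) (adjℕ-sym H) λ a≡b → Graph.irreflexive G a≡b ab))
      (*-comm (adjℕ G a b) K)
    scaled (no ¬ab) = trans (cong (_* S) (ι-false ¬ab)) (trans (sym (*-zeroʳ K)) (cong (K *_) (sym (ι-false ¬ab))))

-- If every injection had excess at least 2, the total excess would be at least twice the number of
-- injections, but it is smaller than that. With fewer than two vertices `G` has no edges and both
-- weights are 0.
light-injection : ∀ {m n} (G : Graph m) (H H′ : Graph n) → m < n → e H ≤ suc (e H′) →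
  ∃[ f ] Injective _≡_ _≡_ f × weight G (adjℕ H) f < weight G (adjℕ H′) f + 2
light-injection {zero} G H H′ m<n eH≤ = (λ ()) , (λ { {()} }) , s≤s z≤n
light-injection {suc zero} {suc n} G H H′ m<n eH≤ =
  (λ _ → zero) , (λ { {zero} {zero} _ → refl }) , edgeless
  where
  edgeless : weight G (adjℕ H) (λ _ → zero) < weight G (adjℕ H′) (λ _ → zero) + 2
  edgeless rewrite adjℕ-diag G zero = s≤s z≤n
light-injection {suc (suc m)} {suc (suc n)} G H H′ (s≤s (s≤s m<n)) eH≤ =
  ∑-inj-<⇒∃< (2 + m) (2 + n) (begin-strict
    ∑-inj (2 + m) (2 + n) (weight G (adjℕ H))
      ≡⟨ ∑-inj-weight m n G H ⟩
    d * (P * ∑∑ (adjℕ H))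
      ≤⟨ *-monoʳ-≤ d (*-monoʳ-≤ P ∑∑H≤) ⟩
    d * (P * (∑∑ (adjℕ H′) + 2))
      ≡⟨ lemma d P (∑∑ (adjℕ H′)) ⟩
    d * (P * ∑∑ (adjℕ H′)) + d * P * 2
      -- Strictness needs `P` positive; what remains is `d < (2 + n) * (1 + n)`, and this product
      -- times `P` is the number of all injections.
      <⟨ +-monoʳ-< (d * (P * ∑∑ (adjℕ H′))) (*-monoˡ-< 2 (*-monoˡ-< P {{>-nonZero (#inj>0 (<⇒≤ m<n))}} d<)) ⟩
    d * (P * ∑∑ (adjℕ H′)) + (2 + n) * (1 + n) * P * 2
      ≡⟨ cong₂ _+_ (sym (∑-inj-weight m n G H′)) (cong (_* 2) (*-assoc (2 + n) (1 + n) P)) ⟩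
    ∑-inj (2 + m) (2 + n) (weight G (adjℕ H′)) + #inj (2 + m) (2 + n) * 2
      ≡⟨ cong (∑-inj (2 + m) (2 + n) (weight G (adjℕ H′)) +_) (∑-inj-const (2 + m) (2 + n) 2) ⟨
    ∑-inj (2 + m) (2 + n) (weight G (adjℕ H′)) + ∑-inj (2 + m) (2 + n) (λ _ → 2)
      ≡⟨ ∑-inj-distrib-+ (2 + m) (2 + n) (weight G (adjℕ H′)) (λ _ → 2) ⟨
    ∑-inj (2 + m) (2 + n) (λ f → weight G (adjℕ H′) f + 2) ∎)
  where
  d = ∑∑ (adjℕ G)
  P = #inj m n

  lemma : ∀ d p w → d * (p * (w + 2)) ≡ d * (p * w) + d * p * 2
  lemma = solve-∀

  ∑∑H≤ : ∑∑ (adjℕ H) ≤ ∑∑ (adjℕ H′) + 2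
  ∑∑H≤ = begin
    ∑∑ (adjℕ H)                   ≡⟨ handshake H ⟩
    e H + e H                     ≤⟨ +-mono-≤ eH≤ eH≤ ⟩
    suc (e H′) + suc (e H′)       ≡⟨ double-suc (e H′) ⟨
    e H′ + e H′ + 2               ≡⟨ cong (_+ 2) (handshake H′) ⟨
    ∑∑ (adjℕ H′) + 2              ∎

  d< : d < (2 + n) * (1 + n)
  d< = begin-strict
    d                              ≤⟨ ∑∑-mono-≤ {2 + m} {adjℕ G} {λ _ _ → 1} (λ a b → ι-≤ {Graph.adj G a b} (λ _ → ≤-refl)) ⟩
    ∑∑ {2 + m} (λ _ _ → 1)         ≡⟨ ∑∑-const (2 + m) 1 ⟩
    (2 + m) * ((2 + m) * 1)        ≡⟨ cong ((2 + m) *_) (*-identityʳ (2 + m)) ⟩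
    -- The crude bound on `d` includes the diagonal of `G`; one spare vertex in the host makes up
    -- for it.
    (2 + m) * (2 + m)              ≤⟨ *-monoʳ-≤ (2 + m) (s≤s m<n) ⟩
    (2 + m) * (1 + n)              <⟨ *-monoˡ-< (1 + n) (s≤s (s≤s m<n)) ⟩
    (2 + n) * (1 + n)              ∎

-- Both weights are doubled edge counts, hence even, so an excess below 2 is no excess.
light-copy : ∀ {m n} (G : Graph m) (H H′ : Graph n) → m < n → e H ≤ suc (e H′) →
             ∃[ F ] IsCopy G F × e (F ∩ H) ≤ e (F ∩ H′)
light-copy G H H′ m<n eH≤ =
  let f , f-inj , lt = light-injection G H H′ m<n eH≤
      F = image G f
      c = image-copy G f f-inj
  in F , c , ≮⇒≥ λ gt → <⇒≱ lt (begin
    weight G (adjℕ H′) f + 2                 ≡⟨ cong (_+ 2) (e-∩-copy {G = G} {F} c H′) ⟨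
    e (F ∩ H′) + e (F ∩ H′) + 2              ≡⟨ double-suc (e (F ∩ H′)) ⟩
    suc (e (F ∩ H′)) + suc (e (F ∩ H′))      ≤⟨ +-mono-≤ gt gt ⟩
    e (F ∩ H) + e (F ∩ H)                    ≡⟨ e-∩-copy {G = G} {F} c H ⟩
    weight G (adjℕ H) f                      ∎)

-- Red edges along a chain of edge-replacements

-- The only edge that can be gained is `{c , d}`, worth two ordered pairs. An upper bound is enough,
-- since the chain is followed from few red edges to many.
replacement-e : ∀ {n} {S S′ : Graph n} → EdgeReplacement S S′ → (H : Graph n) → e (S′ ∩ H) ≤ suc (e (S ∩ H))
replacement-e {n} {S} {S′} (a , b , c , d , _ , _ , adj) H = double-cancel-≤ (begin
  e (S′ ∩ H) + e (S′ ∩ H)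
    ≡⟨ handshake (S′ ∩ H) ⟨
  ∑∑ (adjℕ (S′ ∩ H))
    ≤⟨ ∑∑-mono-≤ pointwise ⟩
  ∑∑ (λ u v → adjℕ (S ∩ H) u v + (at c d u v + at d c u v))
    ≡⟨ ∑∑-distrib-+ (adjℕ (S ∩ H)) _ ⟩
  ∑∑ (adjℕ (S ∩ H)) + ∑∑ (λ u v → at c d u v + at d c u v)
    ≡⟨ cong (∑∑ (adjℕ (S ∩ H)) +_) (trans (∑∑-distrib-+ (at c d) (at d c)) (cong₂ _+_ (∑∑-at c d) (∑∑-at d c))) ⟩
  ∑∑ (adjℕ (S ∩ H)) + 2
    ≡⟨ cong (_+ 2) (handshake (S ∩ H)) ⟩
  e (S ∩ H) + e (S ∩ H) + 2
    ≡⟨ double-suc (e (S ∩ H)) ⟩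
  suc (e (S ∩ H)) + suc (e (S ∩ H)) ∎)
  where
  at? : ∀ x y u v → Dec (u ≡ x × v ≡ y)
  at? x y u v = u Finₚ.≟ x ×-dec v Finₚ.≟ y

  at : Fin n → Fin n → Fin n → Fin n → ℕ
  at x y u v = ι (does (at? x y u v))

  at-yes : ∀ {x y u v} → u ≡ x × v ≡ y → at x y u v ≡ 1
  at-yes {x} {y} {u} {v} h = cong ι (dec-true (at? x y u v) h)

  ∑∑-at : ∀ x y → ∑∑ (at x y) ≡ 1
  ∑∑-at x y = trans (∑∑-single x y λ u v ¬h → cong ι (dec-false (at? x y u v) ¬h)) (at-yes {x} {y} (refl , refl))

  pointwise : ∀ u v → adjℕ (S′ ∩ H) u v ≤ adjℕ (S ∩ H) u v + (at c d u v + at d c u v)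
  pointwise u v = ι-≤ λ p → let uv , h = to T-∧ p in bound h (to (adj u v) uv)
    where
    bound : Adj H u v → (Adj S u v × ¬ SameEdge u v a b) ⊎ SameEdge u v c d →
            1 ≤ adjℕ (S ∩ H) u v + (at c d u v + at d c u v)
    bound h (inj₁ (uv , _)) = ≤-trans (≤-reflexive (sym (ι-true (from T-∧ (uv , h))))) (m≤m+n (adjℕ (S ∩ H) u v) _)
    bound h (inj₂ (inj₁ cd)) = begin
      1                                              ≡⟨ at-yes {c} {d} {u} {v} cd ⟨
      at c d u v                                     ≤⟨ m≤m+n (at c d u v) (at d c u v) ⟩
      at c d u v + at d c u v                        ≤⟨ m≤n+m _ (adjℕ (S ∩ H) u v) ⟩
      adjℕ (S ∩ H) u v + (at c d u v + at d c u v)   ∎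
    bound h (inj₂ (inj₂ dc)) = begin
      1                                              ≡⟨ at-yes {d} {c} {u} {v} dc ⟨
      at d c u v                                     ≤⟨ m≤n+m (at d c u v) (at c d u v) ⟩
      at c d u v + at d c u v                        ≤⟨ m≤n+m _ (adjℕ (S ∩ H) u v) ⟩
      adjℕ (S ∩ H) u v + (at c d u v + at d c u v)   ∎

-- The sequence may drop by any amount but rises by at most one, so it cannot jump over `τ`: from a
-- value below `τ` the next one is still at most `τ`, and the argument restarts there.
intermediate-value : ∀ {t} (k : Fin (suc t) → ℕ) → (∀ i → k (suc i) ≤ suc (k (inject₁ i))) →
                     ∀ {τ} → k zero ≤ τ → τ ≤ k (fromℕ t) → ∃[ i ] k i ≡ τ
intermediate-value {zero}  k step k₀≤τ τ≤kₜ = zero , ≤-antisym k₀≤τ τ≤kₜ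
intermediate-value {suc t} k step {τ} k₀≤τ τ≤kₜ with k zero ≟ τ
... | yes k₀≡τ = zero , k₀≡τ
... | no  k₀≢τ =
  let i , kᵢ≡τ = intermediate-value (k ∘ suc) (step ∘ suc) (≤-trans (step zero) (≤∧≢⇒< k₀≤τ k₀≢τ)) τ≤kₜ
  in suc i , kᵢ≡τ

-- Serves both ends of the chain with the colors exchanged: the first bound limits red in `F`, the
-- second guarantees red in `H`.
half-≤ : ∀ {a b k} → a + b ≡ k → a ≤ b → a ≤ ⌊ k /2⌋ × ⌊ k /2⌋ ≤ b
half-≤ {a} {b} refl a≤b =
  subst (_≤ ⌊ a + b /2⌋) (sym (n≡⌊n+n/2⌋ a)) (⌊n/2⌋-mono (+-monoʳ-≤ a a≤b)) ,
  subst (⌊ a + b /2⌋ ≤_) (sym (n≡⌊n+n/2⌋ b)) (⌊n/2⌋-mono (+-monoˡ-≤ b a≤b))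

-- The 1 is the rounding loss for an odd total; an excess of 2 would lift the half to at least
-- `suc b`.
half≤⇒≤suc : ∀ {a b} → ⌊ a + b /2⌋ ≤ b → a ≤ suc b
half≤⇒≤suc {a} {b} le = ≮⇒≥ λ gt → <⇒≱ (begin-strict
  b                        <⟨ ≤-refl ⟩
  suc b                    ≡⟨ n≡⌊n+n/2⌋ (suc b) ⟩
  ⌊ suc b + suc b /2⌋      ≡⟨ cong (λ k → ⌊ suc k /2⌋) (+-suc b b) ⟩
  ⌊ suc (suc b) + b /2⌋    ≤⟨ ⌊n/2⌋-mono (+-monoˡ-≤ b gt) ⟩
  ⌊ a + b /2⌋              ∎) le

chain-balanced : ∀ {m n} {G : Graph m} {F H : Graph n} (χ : Coloring n) → IsCopy G F → Chain G F H →
                 e (F ∩ R χ) ≤ ⌊ e G /2⌋ → ⌊ e G /2⌋ ≤ e (H ∩ R χ) → BalancedCopy G χ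
chain-balanced {G = G} {F} {H} χ cF (t , S , S₀≈F , Sₜ≈H , steps) F≤ ≤H =
  let i , red = intermediate-value (λ i → e (S i ∩ R χ))
                  (λ i → replacement-e {S = S (inject₁ i)} {S (suc i)} (proj₂ (steps i)) (R χ))
                  (≤-trans (≤-reflexive (∩R-cong {S zero} {F} S₀≈F)) F≤)
                  (≤-trans ≤H (≤-reflexive (sym (∩R-cong {S (fromℕ t)} {H} Sₜ≈H))))
      c = copy i
  -- Red takes the smaller half; the blue count then follows from the total `e G`.
  in inj₂ (S i , c , red , +-cancelˡ-≡ ⌊ e G /2⌋ _ _ (begin-equality
       ⌊ e G /2⌋ + e (S i ∩ B χ)       ≡⟨ cong (_+ e (S i ∩ B χ)) red ⟨
       e (S i ∩ R χ) + e (S i ∩ B χ)   ≡⟨ e-R+B χ (S i) ⟩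
       e (S i)                         ≡⟨ e-copy {G = G} {S i} c ⟩
       e G                             ≡⟨ ⌊n/2⌋+⌈n/2⌉≡n (e G) ⟨
       ⌊ e G /2⌋ + ⌈ e G /2⌉           ∎))
  where
  ∩R-cong : ∀ {F H} → F ≈ H → e (F ∩ R χ) ≡ e (H ∩ R χ)
  ∩R-cong {F} {H} F≈H = e-cong {F = F ∩ R χ} {H ∩ R χ} (∩-cong {F = F} {H} {R χ} {R χ} F≈H (≈-refl {F = R χ}))
  copy : ∀ i → IsCopy G (S i)
  -- A chain certifies copies only after its first graph, which is a copy because it has the edges
  -- of `F`.
  copy zero    = IsCopy-resp-≈ {G = G} {F} {S zero} (≈-sym {F = S zero} {F} S₀≈F) cF
  copy (suc i) = proj₁ (steps i)

-- With `suc s` equal to the half, `s <` the minimum says that each color has at least half of the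
-- edges, rounded down. So each exceeds the other by at most one, and `light-copy` applies in both
-- directions.
half-forces-balanced : ∀ {m n} (G : Graph m) → m < n →
  (∀ F H → IsCopy G F → IsCopy G H → Chain {n = n} G F H) → ∀ {s} → suc s ≡ ⌊ n C 2 /2⌋ → ForcesBalanced n G s
half-forces-balanced {n = n} G m<n chain {s} s≡ χ s< =
  let F , cF , F≤ = light-copy G (R χ) (B χ) m<n (half≤⇒≤suc half≤B)
      H , cH , H≤ = light-copy G (B χ) (R χ) m<n (half≤⇒≤suc half≤R)
  in chain-balanced {G = G} {F} {H} χ cF (chain F H cF cH)
       (proj₁ (half-≤ (trans (e-R+B χ F) (e-copy {G = G} {F} cF)) F≤))
       (proj₂ (half-≤ (trans (+-comm (e (H ∩ B χ)) _) (trans (e-R+B χ H) (e-copy {G = G} {H} cH))) H≤))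
  where
  half≤ : ⌊ n C 2 /2⌋ ≤ e (R χ) ⊓ e (B χ)
  half≤ = subst (_≤ e (R χ) ⊓ e (B χ)) s≡ s<
  half≤B : ⌊ e (R χ) + e (B χ) /2⌋ ≤ e (B χ)
  half≤B = subst (λ k → ⌊ k /2⌋ ≤ e (B χ)) (sym (coloring-e χ)) (≤-trans half≤ (m⊓n≤n (e (R χ)) _))
  half≤R : ⌊ e (B χ) + e (R χ) /2⌋ ≤ e (R χ)
  half≤R = subst (λ k → ⌊ k /2⌋ ≤ e (R χ)) (trans (sym (coloring-e χ)) (+-comm (e (R χ)) _))
             (≤-trans half≤ (m⊓n≤m (e (R χ)) _))

-- Deciding whether a bound forces a balanced copy

-- Vectors stand in for functions, which can be enumerated only up to pointwise equality. The search
-- on `A` is a parameter because entries are vertices in one use and subsets in the other.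
anyVec? : ∀ {A : Set} → (∀ {P : A → Set} → Decidable P → Dec (∃ P)) →
          ∀ {m} {P : Vec A m → Set} → Decidable P → Dec (∃ P)
anyVec? any? {zero}  P? = map′ ([] ,_) (λ { ([] , p) → p }) (P? [])
anyVec? any? {suc m} P? =
  map′ (λ (x , xs , p) → x ∷ xs , p) (λ { (x ∷ xs , p) → x , xs , p })
       (any? λ x → anyVec? any? λ xs → P? (x ∷ xs))

injective? : ∀ {m n} (f : Fin m → Fin n) → Dec (Injective _≡_ _≡_ f)
injective? f = map′ (λ h {a} {b} → h a b) (λ h a b → h)
  (Finₚ.all? λ a → Finₚ.all? λ b → (f a Finₚ.≟ f b) →-dec (a Finₚ.≟ b))

-- Tabulating `f` and looking it up again returns `f` only pointwise, hence the second map `g`.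
IsCopy⇒≈image : ∀ {m n} {G : Graph m} {F : Graph n} ((f , _) : IsCopy G F) {g : Fin m → Fin n} →
                (∀ a → g a ≡ f a) → Injective _≡_ _≡_ g × image G g ≈ F
IsCopy⇒≈image {G = G} (f , f-inj , adj) {g} g≗f = g-inj , λ u v → ⇔.trans (image-adj G g g-inj u v) (⇔.trans
  (mk⇔ (λ (a , b , p , q , ab) → a , b , trans (sym (g≗f a)) p , trans (sym (g≗f b)) q , ab)
       (λ (a , b , p , q , ab) → a , b , trans (g≗f a) p , trans (g≗f b) q , ab))
  (⇔.sym (adj u v)))
  where
  g-inj : Injective _≡_ _≡_ g
  g-inj {a} {b} eq = f-inj (trans (sym (g≗f a)) (trans eq (g≗f b)))

-- An injection determines its copy up to `≈`, and edge counts respect `≈`, so a search over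
-- injections replaces one over graphs.
ColoredCopy? : ∀ {m n} (G : Graph m) (χ : Coloring n) r b → Dec (ColoredCopy G χ r b)
ColoredCopy? {m} {n} G χ r b = map′ sound complete
  (anyVec? Finₚ.any? λ xs → injective? (Vec.lookup xs)
     ×-dec e (image G (Vec.lookup xs) ∩ R χ) ≟ r ×-dec e (image G (Vec.lookup xs) ∩ B χ) ≟ b)
  where
  Good : Vec (Fin n) m → Set
  Good xs = Injective _≡_ _≡_ (Vec.lookup xs) ×
            e (image G (Vec.lookup xs) ∩ R χ) ≡ r × e (image G (Vec.lookup xs) ∩ B χ) ≡ b

  sound : ∃ Good → ColoredCopy G χ r b
  sound (xs , inj , eqs) = image G (Vec.lookup xs) , image-copy G (Vec.lookup xs) inj , eqs

  complete : ColoredCopy G χ r b → ∃ Good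
  complete (F , c , eR , eB) =
    let xs = Vec.tabulate (proj₁ c)
        inj , im≈F = IsCopy⇒≈image {G = G} {F} c (lookup∘tabulate (proj₁ c))
        ∩≡ : ∀ H → e (image G (Vec.lookup xs) ∩ H) ≡ e (F ∩ H)
        ∩≡ H = e-cong {F = image G (Vec.lookup xs) ∩ H} {F ∩ H}
                 (∩-cong {F = image G (Vec.lookup xs)} {F} {H} {H} im≈F (≈-refl {F = H}))
    in xs , inj , trans (∩≡ (R χ)) eR , trans (∩≡ (B χ)) eB

Forces : ∀ {m n} → Graph m → ℕ → Coloring n → Set
Forces G s χ = s < e (R χ) ⊓ e (B χ) → BalancedCopy G χ

Forces? : ∀ {m n} (G : Graph m) s (χ : Coloring n) → Dec (Forces G s χ)
Forces? G s χ = (s <? e (R χ) ⊓ e (B χ)) →-dec (ColoredCopy? G χ _ _ ⊎-dec ColoredCopy? G χ _ _)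

Forces-resp-≈ : ∀ {m n} (G : Graph m) s {χ χ′ : Coloring n} → R χ ≈ R χ′ → B χ ≈ B χ′ → Forces G s χ → Forces G s χ′
Forces-resp-≈ G s {χ} {χ′} R≈ B≈ h s< =
  [ inj₁ ∘ transfer , inj₂ ∘ transfer ]
    (h (subst (s <_) (sym (cong₂ _⊓_ (e-cong {F = R χ} {R χ′} R≈) (e-cong {F = B χ} {B χ′} B≈))) s<))
  where
  ∩≡ : ∀ F {H H′} → H ≈ H′ → e (F ∩ H′) ≡ e (F ∩ H)
  ∩≡ F {H} {H′} H≈H′ = sym (e-cong {F = F ∩ H} {F ∩ H′} (∩-cong {F = F} {F} {H} {H′} (≈-refl {F = F}) H≈H′))
  transfer : ∀ {r b} → ColoredCopy G χ r b → ColoredCopy G χ′ r b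
  transfer (F , c , eR , eB) = F , c , trans (∩≡ F {R χ} {R χ′} R≈) eR , trans (∩≡ F {B χ} {B χ′} B≈) eB

module _ {n} (c : Fin n → Fin n → Bool) where

  -- Symmetrizing `c` and discarding its diagonal makes every Boolean matrix yield a coloring, so
  -- the enumeration needs no validity check.
  Red Blue : Fin n → Fin n → Set
  Red  u v = u ≢ v × (T (c u v) ⊎ T (c v u))
  Blue u v = u ≢ v × ¬ (T (c u v) ⊎ T (c v u))

  either? : ∀ u v → Dec (T (c u v) ⊎ T (c v u))
  either? u v = T? (c u v) ⊎-dec T? (c v u)

  Red? : Binary.Decidable Red
  Red? u v = ¬? (u Finₚ.≟ v) ×-dec either? u v

  Blue? : Binary.Decidable Blue
  Blue? u v = ¬? (u Finₚ.≟ v) ×-dec ¬? (either? u v)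

  Red-sym : Symmetric Red
  Red-sym (u≢v , h) = u≢v ∘ sym , swap h

  Blue-sym : Symmetric Blue
  Blue-sym (u≢v , h) = u≢v ∘ sym , h ∘ swap

  Red-irrefl : Irreflexive _≡_ Red
  Red-irrefl u≡v (u≢v , _) = u≢v u≡v

  Blue-irrefl : Irreflexive _≡_ Blue
  Blue-irrefl u≡v (u≢v , _) = u≢v u≡v

  Adj-red : ∀ u v → Adj (ofDec Red? Red-sym Red-irrefl) u v ⇔ Red u v
  Adj-red = Adj-ofDec Red? Red-sym Red-irrefl

  Adj-blue : ∀ u v → Adj (ofDec Blue? Blue-sym Blue-irrefl) u v ⇔ Blue u v
  Adj-blue = Adj-ofDec Blue? Blue-sym Blue-irrefl

  coloring : Coloring n
  coloring = record
    { R        = ofDec Red? Red-sym Red-irrefl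
    ; B        = ofDec Blue? Blue-sym Blue-irrefl
    ; covers   = λ u v u≢v → Sum.map (from (Adj-red u v) ∘ (u≢v ,_)) (from (Adj-blue u v) ∘ (u≢v ,_))
                                    (toSum (either? u v))
    ; disjoint = λ u v (r , b) → proj₂ (to (Adj-blue u v) b) (proj₂ (to (Adj-red u v) r))
    }

-- The matrix of `R χ` is already symmetric with empty diagonal, so symmetrizing leaves it
-- unchanged; blue is then the complement by `covers` and `disjoint`.
coloring-complete : ∀ {n} (χ : Coloring n) {c : Fin n → Fin n → Bool} → (∀ u v → c u v ≡ Graph.adj (R χ) u v) →
                    R (coloring c) ≈ R χ × B (coloring c) ≈ B χ
coloring-complete χ {c} c≗R = R≈ , B≈
  where
  c⇒R : ∀ {u v} → T (c u v) ⊎ T (c v u) → Adj (R χ) u v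
  c⇒R {u} {v} (inj₁ h) = subst T (c≗R u v) h
  c⇒R {u} {v} (inj₂ h) = Graph.symmetric (R χ) (subst T (c≗R v u) h)

  R⇒c : ∀ {u v} → Adj (R χ) u v → T (c u v) ⊎ T (c v u)
  R⇒c {u} {v} r = inj₁ (subst T (sym (c≗R u v)) r)

  R≈ : R (coloring c) ≈ R χ
  R≈ u v = ⇔.trans (Adj-red c u v)
    (mk⇔ (c⇒R ∘ proj₂) (λ r → (λ u≡v → Graph.irreflexive (R χ) u≡v r) , R⇒c r))

  B≈ : B (coloring c) ≈ B χ
  B≈ u v = ⇔.trans (Adj-blue c u v) (mk⇔
    (λ (u≢v , ¬c) → [ (λ r → contradiction (R⇒c r) ¬c) , id ] (covers χ u v u≢v))
    (λ b → (λ u≡v → Graph.irreflexive (B χ) u≡v b) , λ h → disjoint χ u v (c⇒R h , b)))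

ForcesBalanced? : ∀ {m} n (G : Graph m) s → Dec (ForcesBalanced n G s)
ForcesBalanced? n G s = map′ sound complete
  -- The universal statement is decided as the absence of a counterexample; a row of the matrix is a
  -- `Subset n`.
  (¬? (anyVec? anySubset? λ p → ¬? (Forces? G s (coloring (table p)))))
  where
  table : Vec (Subset n) n → Fin n → Fin n → Bool
  table p u v = Vec.lookup (Vec.lookup p u) v

  complete : ForcesBalanced n G s → ¬ (∃[ p ] ¬ Forces G s (coloring (table p)))
  complete forces (p , ¬forces) = ¬forces (forces (coloring (table p)))

  sound : ¬ (∃[ p ] ¬ Forces G s (coloring (table p))) → ForcesBalanced n G s
  sound ¬∃ χ = Forces-resp-≈ G s {coloring (table p)} {χ} (proj₁ same) (proj₂ same)
    (decidable-stable (Forces? G s (coloring (table p))) λ ¬forces → ¬∃ (p , ¬forces))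
    where
    p : Vec (Subset n) n
    p = Vec.tabulate λ u → Vec.tabulate (Graph.adj (R χ) u)
    same : R (coloring (table p)) ≈ R χ × B (coloring (table p)) ≈ B χ
    same = coloring-complete χ λ u v → trans
      (cong (λ row → Vec.lookup row v) (lookup∘tabulate _ u))
      (lookup∘tabulate (Graph.adj (R χ) u) v)

-- The least forcing bound

least : ∀ {P : ℕ → Set} → Decidable P → ∀ k → P k → ∃[ s ] P s × s ≤ k × (∀ s′ → P s′ → s ≤ s′)
least P? k p with P? 0
... | yes p₀ = 0 , p₀ , z≤n , λ _ _ → z≤n
least P? zero    p | no ¬p₀ = contradiction p ¬p₀
least P? (suc k) p | no ¬p₀ =
  let s , pₛ , s≤k , s-least = least (P? ∘ suc) k p
  in suc s , pₛ , s≤s s≤k , λ { zero p₀ → contradiction p₀ ¬p₀ ; (suc s′) p′ → s≤s (s-least s′ p′) }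

-- The threshold 3 is sharp: C(2,2) = 1 halves to 0, and no `s` lies below 0.
half-nC2>0 : ∀ {n} → 3 ≤ n → ∃[ s ] suc s ≡ ⌊ n C 2 /2⌋
half-nC2>0 {suc n} (s≤s 2≤n) = pred ⌊ suc n C 2 /2⌋ , suc-pred ⌊ suc n C 2 /2⌋ {{>-nonZero (⌊n/2⌋-mono (begin
  2                ≤⟨ 2≤n ⟩
  n                ≡⟨ nC1≡n n ⟨
  n C 1            ≤⟨ m≤m+n (n C 1) (n C 2) ⟩
  n C 1 + n C 2    ≡⟨ nCk+nC[k+1]≡[n+1]C[k+1] n 1 ⟩
  suc n C 2        ∎))}}

theorem2p15 : (m : ℕ) (G : Graph m) → Amoeba G → Balanceable G
theorem2p15 m G (n₀ , m<n₀ , chain) = n₀ ⊔ 3 , λ n N≤n →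
  let n₀≤n = ≤-trans (m≤m⊔n n₀ 3) N≤n
      s₀ , s₀≡ = half-nC2>0 (≤-trans (m≤n⊔m n₀ 3) N≤n)
      s , forces , s≤s₀ , s-least = least (ForcesBalanced? n G) s₀
        (half-forces-balanced G (<-≤-trans m<n₀ n₀≤n) (chain n n₀≤n) s₀≡)
  -- The least forcing bound is at most `s₀`, and `suc s₀` is the half, which gives the strict
  -- inequality.
  in s , (forces , s-least) , subst (s <_) s₀≡ (s≤s s≤s₀)
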